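{- For every $a \in \mathbb{N}$ and every integer $b \ge 2$, $R_\mathrm{ord}(S_a^\mathrm{sc}, C_b^\mathrm{mon}) = 1 + (a-1)(b-1)$.
   Context: All graphs are finite, simple and undirected, and a graph of order $n$ has vertex set $\{0,1,\ldots,n-1\}$; $K_n$ is the complete graph on $\{0,\ldots,n-1\}$. A $2$-edge-coloring of $K_n$ assigns each edge a color in $\{1,2\}$. For a graph $H$ and such a coloring, an embedding of $H$ in color $j$ is an injective map $\varphi\colon V(H)\to V(K_n)$ such that for every edge $uv$ of $H$ the edge $\{\varphi(u),\varphi(v)\}$ has color $j$; it is increasing if $\varphi(0)<\cdots<\varphi(|H|-1)$. The ordered Ramsey number $R_\mathrm{ord}(H_1,H_2)$ is the smallest $n$ such that every $2$-edge-coloring of $K_n$ admits an increasing embedding of $H_1$ in color $1$ or an increasing embedding of $H_2$ in color $2$. The start-central star $S_n^\mathrm{sc}$ is the graph of order $n$ whose edges are exactly $\{0,v\}$ for $1\le v\le n-1$. For $n\ge3$ the monotone cycle $C_n^\mathrm{mon}$ has edges $\{i,i+1\}$ ($0\le i\le n-2$) and $\{0,n-1\}$; by convention $C_2^\mathrm{mon}=K_2$. -}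

module Defs where

open import Data.Nat.Base using (ℕ; suc; _≤_; s≤s)
open import Data.Nat.Properties using (1+n≢n)
open import Data.Fin.Base using (Fin; toℕ; _<_)
open import Data.Product.Base using (_×_; _,_; Σ-syntax)
open import Data.Sum.Base using (_⊎_; inj₁; inj₂)
open import Function.Definitions using (Injective)
open import Level using (0ℓ)
open import Relation.Binary.Core using (Rel; _Preserves_⟶_)
open import Relation.Binary.Definitions using (Symmetric; Irreflexive)
open import Relation.Binary.Construct.Closure.Symmetric using (SymClosure; fwd; bwd; symmetric)
open import Relation.Binary.PropositionalEquality.Core using (_≡_; _≢_; refl; sym; ≢-sym)

record Graph (n : ℕ) : Set₁ where
  field
    Adj    : Rel (Fin n) 0ℓ
    symm   : Symmetric Adj
    irrefl : Irreflexive _≡_ Adj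

fromEdges : ∀ {n} (E : Rel (Fin n) 0ℓ) → Irreflexive _≡_ E → Graph n
fromEdges E irr = record
  { Adj    = SymClosure E
  ; symm   = symmetric E
  ; irrefl = λ { refl (fwd e) → irr refl e ; refl (bwd e) → irr refl e }
  }

K : (n : ℕ) → Graph n
K n = record { Adj = _≢_ ; symm = ≢-sym ; irrefl = λ u≡v u≢v → u≢v u≡v }

data Color : Set where
  color₁ color₂ : Color

-- A 2-edge-coloring of K n.  The values on the diagonal carry no meaning: they
-- are never inspected by an embedding, which is injective on a loopless graph.
record Coloring (n : ℕ) : Set where
  field
    color     : Fin n → Fin n → Color
    color-sym : ∀ u v → color u v ≡ color v u

record IsEmbedding {k n : ℕ} (H : Graph k) (c : Coloring n) (j : Color)
                   (φ : Fin k → Fin n) : Set where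
  open Graph H
  open Coloring c
  field
    injective : Injective _≡_ _≡_ φ
    colored   : ∀ {u v} → Adj u v → color (φ u) (φ v) ≡ j

Increasing : ∀ {k n} → (Fin k → Fin n) → Set
Increasing φ = φ Preserves _<_ ⟶ _<_

HasIncreasingEmbedding : ∀ {k n} → Graph k → Coloring n → Color → Set
HasIncreasingEmbedding {k} {n} H c j =
  Σ[ φ ∈ (Fin k → Fin n) ] IsEmbedding H c j φ × Increasing φ

OrdArrows : ∀ {k l} → ℕ → Graph k → Graph l → Set
OrdArrows n H₁ H₂ = (c : Coloring n) →
  HasIncreasingEmbedding H₁ c color₁ ⊎ HasIncreasingEmbedding H₂ c color₂

-- IsOrdRamsey H₁ H₂ n says R_ord(H₁, H₂) = n, existence of the minimum included.
IsOrdRamsey : ∀ {k l} → Graph k → Graph l → ℕ → Set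
IsOrdRamsey H₁ H₂ n = OrdArrows n H₁ H₂ × (∀ m → OrdArrows m H₁ H₂ → n ≤ m)

Ssc : (n : ℕ) → Graph n
Ssc n = fromEdges (λ u v → toℕ u ≡ 0 × 1 ≤ toℕ v) irr
  where
  irr : Irreflexive _≡_ (λ (u v : Fin n) → toℕ u ≡ 0 × 1 ≤ toℕ v)
  irr {u} refl (u≡0 , 1≤u) with toℕ u
  irr refl (refl , ()) | .0

CycleEdge : ∀ n → Rel (Fin n) 0ℓ
CycleEdge n u v = toℕ v ≡ suc (toℕ u) ⊎ (toℕ u ≡ 0 × suc (toℕ v) ≡ n)

Cmon : (n : ℕ) → 2 ≤ n → Graph n
Cmon 0 ()
Cmon 1 (s≤s ())
Cmon 2 _ = K 2
Cmon n@(suc (suc (suc _))) _ = fromEdges (CycleEdge n) irr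
  where
  irr : Irreflexive _≡_ (CycleEdge n)
  irr refl (inj₁ u≡1+u) = 1+n≢n (sym u≡1+u)
  irr {u} refl (inj₂ (u≡0 , 1+u≡n)) with toℕ u
  irr refl (inj₂ (refl , ())) | .0

{-# OPTIONS --safe #-}
-- The monotone cycle lies between the monotone path P_b and the complete graph K_b on
-- the same vertices, and the bounds already hold for these two.
-- Upper bound for K_b: among the (b - 1)(a - 1) vertices above the least one, either
-- a - 1 are joined to it in color 1, which gives a star, or 1 + (b - 2)(a - 1) are joined
-- to it in color 2; by induction these contain a star, or a clique of order b - 1 that
-- the least vertex extends.
-- Lower bound for P_b: cut (b - 1)(a - 1) vertices into b - 1 consecutive blocks of a - 1
-- vertices, with color 1 inside the blocks and color 2 between them.
module Submission where

open import Data.Nat.Base using (ℕ; zero; suc; _+_; _*_; _∸_; _≤_; z≤n; z<s; s<s; s≤s; s≤s⁻¹)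
import Data.Nat.Base as ℕ
import Data.Nat.Properties as ℕ
open import Data.Fin.Base
  using (Fin; zero; suc; toℕ; fromℕ; inject₁; inject≤; lift; quotient; remainder; remQuot; _<_)
import Data.Fin.Base as Fin
import Data.Fin.Properties as Fin
open import Data.Fin.Induction using (<-weakInduction)
open import Data.Bool.Base using (if_then_else_)
open import Data.Product.Base using (_,_)
open import Data.Sum.Base as Sum using (_⊎_; inj₁; inj₂; [_,_]′)
open import Function.Base using (_∘_)
open import Function.Bundles using (Injection; mk⇔)
open import Function.Definitions using (Injective)
open import Function.Properties.Inverse using (↔⇒↣)
open import Level using (Level; 0ℓ)
open import Relation.Binary.Construct.Closure.Symmetric as SymClosure using (fwd; bwd)
open import Relation.Binary.Core using (_⇒_; _Preserves_⟶_)
open import Relation.Binary.Definitions using (DecidableEquality; tri<; tri≈; tri>)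
open import Relation.Binary.PropositionalEquality using (_≡_; refl; sym; trans; cong; cong₂; subst; subst₂)
open import Relation.Nullary using (¬_; Dec; does; yes; no; contradiction)
open import Relation.Nullary.Decidable using (does-⇔)
open import Relation.Unary using (Pred)
open import Defs

private
  variable
    ℓ : Level
    A : Set ℓ
    k l m n p : ℕ
    P Q : Pred (Fin n) ℓ
    F G H : Graph n
    j : Color

increasing⇒injective : {φ : Fin k → Fin n} → Increasing φ → Injective _≡_ _≡_ φ
increasing⇒injective φ-inc {u} {v} φu≡φv with Fin.<-cmp u v
... | tri< u<v _ _ = contradiction φu≡φv (Fin.<⇒≢ (φ-inc u<v))
... | tri≈ _ u≡v _ = u≡v
... | tri> _ _ v<u = contradiction (sym φu≡φv) (Fin.<⇒≢ (φ-inc v<u))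

lift-increasing : {φ : Fin k → Fin n} → Increasing φ → Increasing (lift 1 φ)
lift-increasing φ-inc {zero}  {suc _} _         = z<s
lift-increasing φ-inc {suc _} {suc _} (s<s u<v) = s<s (φ-inc u<v)

inject≤-increasing : (m≤n : m ≤ n) → Increasing (λ i → inject≤ i m≤n)
inject≤-increasing m≤n {i} {j} =
  subst₂ ℕ._<_ (sym (Fin.toℕ-inject≤ i m≤n)) (sym (Fin.toℕ-inject≤ j m≤n))

stepwise-increasing⇒< : {f : Fin (suc k) → Fin n} → (∀ i → f (inject₁ i) < f (suc i)) → k ℕ.< n
stepwise-increasing⇒< {k} {n} {f} f-step = begin-strict
  k                  ≡⟨ Fin.toℕ-fromℕ k ⟨
  toℕ (fromℕ k)      ≤⟨ <-weakInduction (λ i → toℕ i ≤ toℕ (f i)) z≤n ≤-step (fromℕ k) ⟩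
  toℕ (f (fromℕ k))  <⟨ Fin.toℕ<n (f (fromℕ k)) ⟩
  n                  ∎
  where
  open ℕ.≤-Reasoning
  ≤-step : ∀ i → toℕ (inject₁ i) ≤ toℕ (f (inject₁ i)) → suc (toℕ i) ≤ toℕ (f (suc i))
  ≤-step i i≤fi = ℕ.≤-<-trans (subst (_≤ toℕ (f (inject₁ i))) (Fin.toℕ-inject₁ i) i≤fi) (f-step i)

record Subsequence {n : ℕ} {ℓ : Level} (k : ℕ) (P : Pred (Fin n) ℓ) : Set ℓ where
  constructor subsequence
  field
    index      : Fin k → Fin n
    increasing : Increasing index
    satisfies  : ∀ i → P (index i)

empty : Subsequence 0 P
empty = subsequence (λ ()) (λ {}) λ ()

skip : Subsequence k (P ∘ suc) → Subsequence k P
skip (subsequence φ φ-inc Pφ) = subsequence (suc ∘ φ) (s<s ∘ φ-inc) Pφ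

keep : P zero → Subsequence k (P ∘ suc) → Subsequence (suc k) P
keep P₀ (subsequence φ φ-inc Pφ) =
  subsequence (lift 1 φ) (lift-increasing φ-inc) λ { zero → P₀ ; (suc i) → Pφ i }

subsequence-pigeonhole : k + l ≤ suc n → (∀ i → P i ⊎ Q i) → Subsequence {n} k P ⊎ Subsequence l Q
subsequence-pigeonhole {zero}          _ _ = inj₁ empty
subsequence-pigeonhole {suc _} {zero}  _ _ = inj₂ empty
subsequence-pigeonhole {suc k} {suc l} {zero} k+l≤1 _ =
  contradiction (ℕ.≤-trans (ℕ.m≤n+m (suc l) k) (s≤s⁻¹ k+l≤1)) λ ()
subsequence-pigeonhole {suc k} {suc l} {suc n} k+l≤2+n P∪Q with P∪Q zero
... | inj₁ P₀ = Sum.map (keep P₀) skip (subsequence-pigeonhole (s≤s⁻¹ k+l≤2+n) (P∪Q ∘ suc))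
... | inj₂ Q₀ = Sum.map skip (keep Q₀) (subsequence-pigeonhole
  (subst (_≤ suc n) (ℕ.+-suc k l) (s≤s⁻¹ k+l≤2+n)) (P∪Q ∘ suc))

infix 4 _⊆_

_⊆_ : Graph n → Graph n → Set
G ⊆ H = Graph.Adj G ⇒ Graph.Adj H

⊆-K : (G : Graph n) → G ⊆ K n
⊆-K G uv u≡v = Graph.irrefl G u≡v uv

Pmon : (n : ℕ) → Graph n
Pmon n = fromEdges (λ u v → toℕ v ≡ suc (toℕ u)) λ { refl u≡1+u → ℕ.1+n≢n (sym u≡1+u) }

Pmon⊆Cmon : (2≤n : 2 ≤ n) → Pmon n ⊆ Cmon n 2≤n
Pmon⊆Cmon {1} (s≤s ())
Pmon⊆Cmon {2} _ = ⊆-K (Pmon 2)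
Pmon⊆Cmon {suc (suc (suc _))} _ = SymClosure.map inj₁

embedding-antimono-⊆ : {c : Coloring n} → G ⊆ H →
                       HasIncreasingEmbedding H c j → HasIncreasingEmbedding G c j
embedding-antimono-⊆ G⊆H (φ , emb , φ-inc) =
  φ , record { injective = injective ; colored = colored ∘ G⊆H } , φ-inc
  where open IsEmbedding emb

OrdArrows-antimonoʳ-⊆ : G ⊆ H → OrdArrows n F H → OrdArrows n F G
OrdArrows-antimonoʳ-⊆ G⊆H arrows c = Sum.map₂ (embedding-antimono-⊆ G⊆H) (arrows c)

pullback : (Fin m → Fin n) → Coloring n → Coloring m
pullback φ c = record
  { color     = λ u v → color (φ u) (φ v)
  ; color-sym = λ u v → color-sym (φ u) (φ v)
  }
  where open Coloring c

pushforward-embedding : {φ : Fin m → Fin n} {c : Coloring n} → Increasing φ →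
              HasIncreasingEmbedding H (pullback φ c) j → HasIncreasingEmbedding H c j
pushforward-embedding {φ = φ} φ-inc (ψ , emb , ψ-inc) = φ ∘ ψ ,
  record { injective = injective ∘ increasing⇒injective φ-inc ; colored = colored } , φ-inc ∘ ψ-inc
  where open IsEmbedding emb

OrdArrows-mono-≤ : m ≤ n → OrdArrows m G H → OrdArrows n G H
OrdArrows-mono-≤ m≤n arrows c =
  Sum.map extend extend (arrows (pullback (λ i → inject≤ i m≤n) c))
  where
  extend : HasIncreasingEmbedding H (pullback (λ i → inject≤ i m≤n) c) j →
           HasIncreasingEmbedding H c j
  extend = pushforward-embedding (inject≤-increasing m≤n)

threshold⇒isOrdRamsey : OrdArrows (suc n) G H → ¬ OrdArrows n G H → IsOrdRamsey G H (suc n)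
threshold⇒isOrdRamsey arrows ¬arrows =
  arrows , λ m arrowsₘ → ℕ.≰⇒> λ m≤n → ¬arrows (OrdArrows-mono-≤ m≤n arrowsₘ)

color₁⊎color₂ : ∀ j → j ≡ color₁ ⊎ j ≡ color₂
color₁⊎color₂ color₁ = inj₁ refl
color₁⊎color₂ color₂ = inj₂ refl

module _ (c : Coloring (suc n)) where
  open Coloring c
  open Subsequence using (index)

  Joined : Color → Pred (Fin n) 0ℓ
  Joined j v = color zero (suc v) ≡ j

  cone-embedding : (H : Graph (suc k)) (S : Subsequence k (Joined j)) → let φ = index S in
                   (∀ {u v} → Graph.Adj H (suc u) (suc v) → color (suc (φ u)) (suc (φ v)) ≡ j) →
                   HasIncreasingEmbedding H c j
  cone-embedding {j = j} H (subsequence φ φ-inc joined) base = lift 1 φ ,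
    record { injective = increasing⇒injective (lift-increasing φ-inc) ; colored = colored } ,
    lift-increasing φ-inc
    where
    open Graph H
    colored : ∀ {u v} → Adj u v → color (lift 1 φ u) (lift 1 φ v) ≡ j
    colored {zero}  {zero}  uv = contradiction uv (irrefl refl)
    colored {zero}  {suc v} _  = joined v
    colored {suc u} {zero}  _  = trans (color-sym _ _) (joined u)
    colored {suc _} {suc _} uv = base uv

  star-embedding : Subsequence k (Joined j) → HasIncreasingEmbedding (Ssc (suc k)) c j
  star-embedding leaves = cone-embedding (Ssc _) leaves λ { (fwd (() , _)) ; (bwd (() , _)) }

  clique-embedding : (S : Subsequence m (Joined j)) →
                     HasIncreasingEmbedding (K k) (pullback (suc ∘ index S) c) j →
                     HasIncreasingEmbedding (K (suc k)) c j
  clique-embedding (subsequence φ φ-inc joined) (ψ , emb , ψ-inc) =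
    cone-embedding (K _) (subsequence (φ ∘ ψ) (φ-inc ∘ ψ-inc) (joined ∘ ψ))
      λ u≢v → IsEmbedding.colored emb (u≢v ∘ cong suc)

star-clique-arrows : ∀ p q → OrdArrows (suc (q * p)) (Ssc (suc p)) (K (suc q))
star-clique-arrows p zero    c = inj₂ (cone-embedding c (K 1) empty λ {})
star-clique-arrows p (suc q) c
  with subsequence-pigeonhole (ℕ.≤-reflexive (ℕ.+-suc p (q * p)))
                              (λ v → color₁⊎color₂ (Coloring.color c zero (suc v)))
... | inj₁ leaves = inj₁ (star-embedding c leaves)
... | inj₂ S = Sum.map (pushforward-embedding (s<s ∘ increasing)) (clique-embedding c S)
                       (star-clique-arrows p q (pullback (suc ∘ index) c))
  where open Subsequence S

dec-color : Dec A → Color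
dec-color A? = if does A? then color₁ else color₂

dec-color≡color₁ : (A? : Dec A) → dec-color A? ≡ color₁ → A
dec-color≡color₁ (yes a) _ = a

dec-color≡color₂ : (A? : Dec A) → dec-color A? ≡ color₂ → ¬ A
dec-color≡color₂ (no ¬a) _ = ¬a

fibreColoring : DecidableEquality A → (Fin n → A) → Coloring n
fibreColoring _≟_ f = record
  { color     = λ u v → dec-color (f u ≟ f v)
  ; color-sym = λ u v → cong (if_then color₁ else color₂)
                             (does-⇔ (mk⇔ sym sym) (f u ≟ f v) (f v ≟ f u))
  }

fibreColoring-star-free : (_≟_ : DecidableEquality A) (f : Fin n → A) (g : Fin n → Fin p) →
                          Injective _≡_ _≡_ (λ u → f u , g u) →
                          ¬ HasIncreasingEmbedding (Ssc (suc p)) (fibreColoring _≟_ f) color₁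
fibreColoring-star-free _≟_ f g fg-injective (φ , emb , _) =
  Fin.<⇒notInjective (ℕ.n<1+n _) g∘φ-injective
  where
  open IsEmbedding emb
  center-fibre : ∀ i → f (φ zero) ≡ f (φ i)
  center-fibre zero    = refl
  center-fibre (suc i) = dec-color≡color₁ (_ ≟ _) (colored (fwd (refl , z<s)))

  g∘φ-injective : Injective _≡_ _≡_ (g ∘ φ)
  g∘φ-injective {u} {v} gφu≡gφv =
    injective (fg-injective (cong₂ _,_ (trans (sym (center-fibre u)) (center-fibre v)) gφu≡gφv))

fibreColoring-path-free : {f : Fin n → Fin k} → f Preserves Fin._≤_ ⟶ Fin._≤_ →
                          ¬ HasIncreasingEmbedding (Pmon (suc k)) (fibreColoring Fin._≟_ f) color₂
fibreColoring-path-free {f = f} f-mono (φ , emb , φ-inc) =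
  ℕ.<-irrefl refl (stepwise-increasing⇒< {f = f ∘ φ} f∘φ-step)
  where
  open IsEmbedding emb
  f∘φ-step : ∀ i → f (φ (inject₁ i)) < f (φ (suc i))
  f∘φ-step i = Fin.≤∧≢⇒< (f-mono (ℕ.<⇒≤ (φ-inc (Fin.≤̄⇒inject₁< ℕ.≤-refl))))
    (dec-color≡color₂ (_ Fin.≟ _) (colored (fwd (cong suc (sym (Fin.toℕ-inject₁ i))))))

quotient-mono-≤ : ∀ m p → quotient {m} p Preserves Fin._≤_ ⟶ Fin._≤_
quotient-mono-≤ m p {u} {v} u≤v = ℕ.≮⇒≥ λ qv<qu → ℕ.<⇒≱
  (subst₂ _<_ (Fin.combine-remQuot {m} p v) (Fin.combine-remQuot {m} p u)
    (Fin.combine-monoˡ-< _ _ qv<qu))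
  u≤v

remQuot-injective : ∀ m p → Injective _≡_ _≡_ (remQuot {m} p)
remQuot-injective m p = Injection.injective (↔⇒↣ (Fin.*↔× {m} {p}))

star-path-¬arrows : ∀ p q → ¬ OrdArrows (q * p) (Ssc (suc p)) (Pmon (suc q))
star-path-¬arrows p q arrows =
  [ fibreColoring-star-free Fin._≟_ (quotient p) (remainder {q} p) (remQuot-injective q p)
  , fibreColoring-path-free (quotient-mono-≤ q p)
  ]′ (arrows (fibreColoring Fin._≟_ (quotient {q} p)))

star-isOrdRamsey : ∀ p {q} (H : Graph (suc q)) → Pmon (suc q) ⊆ H →
                   IsOrdRamsey (Ssc (suc p)) H (suc (q * p))
star-isOrdRamsey p {q} H Pmon⊆H = threshold⇒isOrdRamsey
  (OrdArrows-antimonoʳ-⊆ (⊆-K H) (star-clique-arrows p q))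
  (λ arrows → star-path-¬arrows p q (OrdArrows-antimonoʳ-⊆ Pmon⊆H arrows))

theorem4p18 : (a b : ℕ) → 1 ≤ a → (2≤b : 2 ≤ b) →
    IsOrdRamsey (Ssc a) (Cmon b 2≤b) (1 + (a ∸ 1) * (b ∸ 1))
theorem4p18 (suc p) (suc q) _ 2≤b rewrite ℕ.*-comm p q =
  star-isOrdRamsey p (Cmon (suc q) 2≤b) (Pmon⊆Cmon 2≤b)
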